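{- Let $G$ be the corresponding graph of an array $A$ with reach one, let $F$ be a resulting DFS forest of $G$, and let $T$ be a component of $F$ whose root $v$ has exactly two children $a_1,b_1$ (i.e. $T$ has two sub-trees stemming from the root). Apply the sub-tree merge to $T$ and let $H$ be $T$ together with all arcs added. Then $H$ contains a directed Hamiltonian path, i.e. a directed path visiting every vertex of $T$ exactly once.
   Context: An array is a finite sequence $A=(A[1],\dots,A[n])$ of pairwise distinct real numbers. The corresponding graph of $A$ with reach one is the directed graph on $\{1,\dots,n\}$ with an arc $(i,j)$ whenever $j\equiv i\pm1\pmod n$, $j\ne i$, and $A[i]<A[j]$. DFS is run with adjacency lists sorted in increasing $A$-value and a visiting list containing all vertices; the resulting DFS forest consists of the arcs $(\mathrm{parent}(w),w)$ along which DFS discovers vertices, and its components (of the underlying undirected graph) are rooted trees. Sub-tree merge of $T$: set $p=a_1$, $q=b_1$; while both $p,q$ are defined: if $A[p]<A[q]$, add the arc $(p,q)$ and replace $p$ by its smallest-valued child in $F$ (undefined if it has none); otherwise add the arc $(q,p)$ and replace $q$ by its smallest-valued child in $F$ (undefined if none). -}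

module Defs where

open import Data.Fin using (Fin; toℕ)
open import Data.Integer using (ℤ; +_; 1ℤ) renaming (_+_ to _+ℤ_; _-_ to _-ℤ_)
open import Data.Integer.Divisibility using () renaming (_∣_ to _∣ℤ_)
open import Data.List using (List; []; _∷_)
open import Data.List.Membership.Propositional using (_∈_; _∉_)
open import Data.List.Relation.Unary.Linked using (Linked)
open import Data.List.Relation.Unary.Unique.Propositional using (Unique)
open import Data.Maybe using (Maybe; just; nothing)
open import Data.Nat using (ℕ)
open import Data.Product using (_×_; _,_)
open import Data.Sum using (_⊎_)
open import Data.Vec.Functional using (Vector)
open import Function.Bundles using (_⇔_)
open import Level using (0ℓ; _⊔_)
open import Relation.Binary.Bundles using (StrictTotalOrder)
open import Relation.Binary.Construct.Closure.Equivalence using (EqClosure)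
open import Relation.Binary.Core using (Rel)
open import Relation.Binary.PropositionalEquality using (_≡_; _≢_)
open import Relation.Nullary using (¬_)
open import Relation.Unary using (Pred)

_≡_[mod_] : ℤ → ℤ → ℕ → Set
x ≡ y [mod n ] = (+ n) ∣ℤ (x -ℤ y)

------------------------------------------------------------------------
-- Forests, given by their list of arcs (parent , child)

module _ {n : ℕ} where

  Arc : List (Fin n × Fin n) → Rel (Fin n) 0ℓ
  Arc F u w = (u , w) ∈ F

  IsRoot : List (Fin n × Fin n) → Pred (Fin n) 0ℓ
  IsRoot F v = ∀ u → ¬ Arc F u v

  HasExactlyTwoChildren : List (Fin n × Fin n) → (v a b : Fin n) → Set
  HasExactlyTwoChildren F v a b =
    a ≢ b × (∀ w → Arc F v w ⇔ (w ≡ a ⊎ w ≡ b))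

  Component : List (Fin n × Fin n) → Fin n → Pred (Fin n) 0ℓ
  Component F v w = EqClosure (Arc F) v w

  record IsHamiltonianPath {ℓ₁ ℓ₂} (V : Pred (Fin n) ℓ₁) (E : Rel (Fin n) ℓ₂)
                           (path : List (Fin n)) : Set (ℓ₁ ⊔ ℓ₂) where
    field
      followsArcs : Linked E path
      noRepeats   : Unique path
      visits      : ∀ w → w ∈ path ⇔ V w

------------------------------------------------------------------------
-- Depth-first search, as a big-step semantics

record State (n : ℕ) : Set where
  constructor state
  field
    visited : List (Fin n)
    arcs    : List (Fin n × Fin n)
open State

mark : ∀ {n} → Fin n → State n → State n
mark u s = state (u ∷ visited s) (arcs s)

addArc : ∀ {n} → Fin n → Fin n → State n → State n
addArc u w s = state (visited s) ((u , w) ∷ arcs s)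

module _ {n : ℕ} (adj : Fin n → List (Fin n)) where

  mutual
    data Explore (u : Fin n) (s : State n) : State n → Set where
      explore : ∀ {s′} → Scan u (adj u) (mark u s) s′ → Explore u s s′

    -- Scan u ws s s′: processing the remaining neighbours ws of u
    -- turns state s into s′.
    data Scan (u : Fin n) : List (Fin n) → State n → State n → Set where
      done     : ∀ {s} → Scan u [] s s
      skip     : ∀ {w ws s s′} → w ∈ visited s →
                 Scan u ws s s′ → Scan u (w ∷ ws) s s′
      discover : ∀ {w ws s s′ s″} → w ∉ visited s →
                 Explore w (addArc u w s) s′ → Scan u ws s′ s″ →
                 Scan u (w ∷ ws) s s″

  data Search : List (Fin n) → State n → State n → Set where
    done  : ∀ {s} → Search [] s s
    skip  : ∀ {v vs s s′} → v ∈ visited s →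
            Search vs s s′ → Search (v ∷ vs) s s′
    start : ∀ {v vs s s′ s″} → v ∉ visited s →
            Explore v s s′ → Search vs s′ s″ → Search (v ∷ vs) s s″

------------------------------------------------------------------------
-- Arrays.  Only the order of the entries is ever used, so they are taken
-- from an arbitrary strict total order.

module _ {c ℓ₁ ℓ₂} (O : StrictTotalOrder c ℓ₁ ℓ₂) where
  open StrictTotalOrder O using (Carrier; _≈_; _<_)

  Distinct : ∀ {n} → Vector Carrier n → Set ℓ₁
  Distinct A = ∀ {i j} → i ≢ j → ¬ (A i ≈ A j)

  module _ {n : ℕ} (A : Vector Carrier n) where

    -- Positions are numbered from 0, which does not affect
    -- adjacency modulo n.
    ReachOne : Rel (Fin n) ℓ₂
    ReachOne i j =
      ((+ toℕ j) ≡ (+ toℕ i) +ℤ 1ℤ [mod n ] ⊎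
       (+ toℕ j) ≡ (+ toℕ i) -ℤ 1ℤ [mod n ])
      × j ≢ i
      × A i < A j

    record IsSortedAdjacency (adj : Fin n → List (Fin n)) : Set ℓ₂ where
      field
        lists  : ∀ u w → w ∈ adj u ⇔ ReachOne u w
        sorted : ∀ u → Linked (λ x y → A x < A y) (adj u)

    record IsDFSForest (F : List (Fin n × Fin n)) : Set ℓ₂ where
      field
        adj          : Fin n → List (Fin n)
        adjacency    : IsSortedAdjacency adj
        visitingList : List (Fin n)
        containsAll  : ∀ v → v ∈ visitingList
        finalVisited : List (Fin n)
        run          : Search adj visitingList (state [] [])
                                               (state finalVisited F)

    module _ (F : List (Fin n × Fin n)) where

      data SmallestChild (p : Fin n) : Maybe (Fin n) → Set ℓ₂ where
        undefined : (∀ w → ¬ Arc F p w) → SmallestChild p nothing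
        defined   : ∀ {m} → Arc F p m →
                    (∀ w → Arc F p w → ¬ (A w < A m)) →
                    SmallestChild p (just m)

      -- The values of (p , q) that occur at the head of the merge loop
      -- started at (a , b).  Describing the loop by its reachable states
      -- makes the set of added arcs meaningful without assuming that the
      -- loop terminates.
      data MergeState (a b : Fin n) : (p q : Maybe (Fin n)) → Set ℓ₂ where
        initial  : MergeState a b (just a) (just b)
        advanceP : ∀ {p q p′} → MergeState a b (just p) (just q) →
                   A p < A q → SmallestChild p p′ →
                   MergeState a b p′ (just q)
        advanceQ : ∀ {p q q′} → MergeState a b (just p) (just q) →
                   ¬ (A p < A q) → SmallestChild q q′ →
                   MergeState a b (just p) q′

      data MergeArc (a b : Fin n) : Rel (Fin n) ℓ₂ where
        fromP : ∀ {p q} → MergeState a b (just p) (just q) →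
                A p < A q → MergeArc a b p q
        fromQ : ∀ {p q} → MergeState a b (just p) (just q) →
                ¬ (A p < A q) → MergeArc a b q p

      MergedArc : (v a b : Fin n) → Rel (Fin n) ℓ₂
      MergedArc v a b u w =
        (Component F v u × Component F v w × Arc F u w) ⊎ MergeArc a b u w

{-# OPTIONS --safe #-}

-- In a cycle every vertex has two neighbours, and along a DFS forest each
-- vertex has at most one parent.  So a non-root vertex, having spent one of its
-- neighbours on its parent, has at most one child, and the two sub-trees below
-- v are disjoint paths.  The merge visits them so that every vertex it leaves
-- has arcs to both current heads (one from the forest, one added), hence to the
-- vertex left next.  All these arcs increase A, so no vertex repeats.

module Submission where

open import Defs
open import Data.Empty using (⊥)
open import Data.Fin using (Fin; toℕ)
open import Data.Fin.Induction using (spo-noetherian)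
open import Data.Fin.Properties using (toℕ<n; toℕ-injective; _≟_)
open import Data.Integer using (+_; -_; 1ℤ; ∣_∣) renaming (_+_ to _+ℤ_; _-_ to _-ℤ_)
open import Data.Integer.Divisibility using () renaming (_∣_ to _∣ℤ_)
open import Data.Integer.Divisibility.Signed using (∣ᵤ⇒∣; ∣⇒∣ᵤ; ∣m∣n⇒∣m-n; ∣m⇒∣-m)
open import Data.Integer.Properties
  using (∣i∣≡0⇒i≡0; i-j≡0⇒i≡j; +-injective; m-n≡m⊖n; ∣m⊝n∣≤m⊔n)
open import Data.Integer.Tactic.RingSolver using (solve-∀)
open import Data.List using (List; []; _∷_)
open import Data.List.Membership.Propositional using (_∈_; _∉_; find; lose)
import Data.List.Relation.Unary.AllPairs as AllPairs
open import Data.List.Relation.Unary.Any using (here; there; any?)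
open import Data.List.Relation.Unary.Linked as Linked using (Linked; [-]; _∷_)
open import Data.List.Relation.Unary.Linked.Properties using (Linked⇒AllPairs)
open import Data.List.Relation.Unary.Unique.Propositional using (Unique)
open import Data.Maybe using (just)
open import Data.Nat using (ℕ; zero; suc; _<_)
open import Data.Nat.Divisibility using (_∣_; >⇒∤)
open import Data.Nat.Properties using (≤-<-trans; ⊔-pres-<m)
open import Data.Product using (_×_; _,_; ∃; proj₁; proj₂)
open import Data.Sum using (_⊎_; inj₁; inj₂; [_,_]′; map₁; map₂; swap; assocʳ)
open import Data.Vec.Functional using (Vector)
open import Function using (flip; _∘_; id)
open import Function.Bundles using (mk⇔; Equivalence)
open import Induction.WellFounded using (Acc; acc)
open import Level using (0ℓ; _⊔_)
open import Relation.Binary.Bundles using (StrictTotalOrder)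
open import Relation.Binary.Construct.Closure.ReflexiveTransitive as Star
  using (Star; ε; _◅_; _◅◅_)
open import Relation.Binary.Construct.Closure.Symmetric using (fwd; bwd)
import Relation.Binary.Construct.On as On
open import Relation.Binary.Core using (Rel)
open import Relation.Binary.Definitions using (tri<; tri≈; tri>)
open import Relation.Binary.PropositionalEquality using (_≡_; _≢_; refl; sym; cong; subst)
open import Relation.Nullary using (¬_; yes; no)
open import Relation.Nullary.Negation using (contradiction)
open import Relation.Unary using (Pred; _∪_)

-- Neighbours on the cycle

∣∧<⇒≡0 : ∀ {m k} → m ∣ k → k < m → k ≡ 0
∣∧<⇒≡0 {k = zero}  _   _   = refl
∣∧<⇒≡0 {k = suc _} m∣k k<m = contradiction m∣k (>⇒∤ k<m)

-- Both indices lie between 0 and `n - 1`, so their difference has absolute value below `n`; being a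
-- multiple of `n`, it is zero.
toℕ-mod-injective : ∀ {n} {x y : Fin n} {c} →
                    (+ toℕ x) ≡ c [mod n ] → (+ toℕ y) ≡ c [mod n ] → x ≡ y
toℕ-mod-injective {n} {x} {y} {c} x≡c y≡c =
  toℕ-injective (+-injective (i-j≡0⇒i≡j _ _ (∣i∣≡0⇒i≡0 (∣∧<⇒≡0 n∣x-y x-y<n))))
  where
  cancel : ∀ x y c → (x -ℤ c) -ℤ (y -ℤ c) ≡ x -ℤ y
  cancel = solve-∀

  n∣x-y : (+ toℕ x) ≡ + toℕ y [mod n ]
  n∣x-y = subst (λ d → (+ n) ∣ℤ d) (cancel (+ toℕ x) (+ toℕ y) c)
            (∣⇒∣ᵤ (∣m∣n⇒∣m-n {+ n} {+ toℕ x -ℤ c} {+ toℕ y -ℤ c} (∣ᵤ⇒∣ {+ n} x≡c) (∣ᵤ⇒∣ {+ n} y≡c)))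

  x-y<n : ∣ + toℕ x -ℤ + toℕ y ∣ < n
  x-y<n = subst (λ d → ∣ d ∣ < n) (sym (m-n≡m⊖n (toℕ x) (toℕ y)))
            (≤-<-trans (∣m⊝n∣≤m⊔n (toℕ x) (toℕ y)) (⊔-pres-<m (toℕ<n x) (toℕ<n y)))

Adjacent : ∀ {n} → Rel (Fin n) 0ℓ
Adjacent {n} i j = (+ toℕ j) ≡ (+ toℕ i) +ℤ 1ℤ [mod n ] ⊎
                   (+ toℕ j) ≡ (+ toℕ i) -ℤ 1ℤ [mod n ]

adjacent-sym : ∀ {n} {i j : Fin n} → Adjacent i j → Adjacent j i
adjacent-sym {n} {i} {j} =
  [ inj₂ ∘ negate (neg₁ (+ toℕ j) (+ toℕ i)) , inj₁ ∘ negate (neg₂ (+ toℕ j) (+ toℕ i)) ]′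
  where
  neg₁ : ∀ y x → - (y -ℤ (x +ℤ 1ℤ)) ≡ x -ℤ (y -ℤ 1ℤ)
  neg₁ = solve-∀

  neg₂ : ∀ y x → - (y -ℤ (x -ℤ 1ℤ)) ≡ x -ℤ (y +ℤ 1ℤ)
  neg₂ = solve-∀

  negate : ∀ {d e} → - d ≡ e → (+ n) ∣ℤ d → (+ n) ∣ℤ e
  negate {d} eq n∣d = subst (λ e → (+ n) ∣ℤ e) eq (∣⇒∣ᵤ (∣m⇒∣-m {+ n} {d} (∣ᵤ⇒∣ {+ n} n∣d)))

-- Pigeonhole: the three indices fall into the residue classes of `w + 1` and `w - 1`, each of which
-- contains a single index. One class is taken by `u`, which leaves the other for `x` and `y`.
other-neighbour-unique : ∀ {n} {w u x y : Fin n} →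
                         Adjacent w u → Adjacent w x → Adjacent w y →
                         u ≢ x → u ≢ y → x ≡ y
other-neighbour-unique {n} {w} {u} {x} {y} = go
  where
  same : ∀ {x y c} → (+ toℕ x) ≡ c [mod n ] → (+ toℕ y) ≡ c [mod n ] → x ≡ y
  same {x} {y} {c} = toℕ-mod-injective {n} {x} {y} {c}

  go : Adjacent w u → Adjacent w x → Adjacent w y → u ≢ x → u ≢ y → x ≡ y
  go (inj₁ u+) (inj₁ x+) _         u≢x _   = contradiction (same {c = + toℕ w +ℤ 1ℤ} u+ x+) u≢x
  go (inj₁ u+) (inj₂ _)  (inj₁ y+) _   u≢y = contradiction (same {c = + toℕ w +ℤ 1ℤ} u+ y+) u≢y
  go (inj₁ _)  (inj₂ x-) (inj₂ y-) _   _   = same {c = + toℕ w -ℤ 1ℤ} x- y-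
  go (inj₂ u-) (inj₂ x-) _         u≢x _   = contradiction (same {c = + toℕ w -ℤ 1ℤ} u- x-) u≢x
  go (inj₂ u-) (inj₁ _)  (inj₂ y-) _   u≢y = contradiction (same {c = + toℕ w -ℤ 1ℤ} u- y-) u≢y
  go (inj₂ _)  (inj₁ x+) (inj₁ y+) _   _   = same {c = + toℕ w +ℤ 1ℤ} x+ y+

-- Depth-first search forests

UniqueParents : ∀ {n} → List (Fin n × Fin n) → Set
UniqueParents F = ∀ {u u′ w} → Arc F u w → Arc F u′ w → u ≡ u′

module _ {n : ℕ} (adj : Fin n → List (Fin n)) where

  open State

  -- `targetsVisited` makes `uniqueParents` inductive: an unvisited vertex has no incoming arc yet,
  -- so the arc that discovers it is its first.
  record Invariant (s : State n) : Set where
    field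
      arcsFollowAdj  : ∀ {u w} → Arc (arcs s) u w → w ∈ adj u
      targetsVisited : ∀ {u w} → Arc (arcs s) u w → w ∈ visited s
      uniqueParents  : UniqueParents (arcs s)
  open Invariant

  invariant-initial : Invariant (state [] [])
  invariant-initial = record
    { arcsFollowAdj = λ () ; targetsVisited = λ () ; uniqueParents = λ () }

  invariant-mark : ∀ {u s} → Invariant s → Invariant (mark u s)
  invariant-mark inv = record
    { arcsFollowAdj  = arcsFollowAdj inv
    ; targetsVisited = there ∘ targetsVisited inv
    ; uniqueParents  = uniqueParents inv }

  -- The arc is added before its target is marked, so the invariant is only
  -- restored by the marking that opens the exploration of the target.
  invariant-discover : ∀ {u w s} → w ∈ adj u → w ∉ visited s →
                       Invariant s → Invariant (mark w (addArc u w s))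
  invariant-discover {u} {w} {s} w∈adj w∉s inv = record
    { arcsFollowAdj = λ { (here refl) → w∈adj ; (there e) → arcsFollowAdj inv e }
    ; targetsVisited = λ { (here refl) → here refl ; (there e) → there (targetsVisited inv e) }
    ; uniqueParents = unique }
    where
    unique : UniqueParents ((u , w) ∷ arcs s)
    unique (here refl) (here refl) = refl
    unique (here refl) (there e)   = contradiction (targetsVisited inv e) w∉s
    unique (there e)   (here refl) = contradiction (targetsVisited inv e) w∉s
    unique (there e)   (there e′)  = uniqueParents inv e e′

  mutual
    explore-invariant : ∀ {u s s′} → Explore adj u s s′ → Invariant (mark u s) → Invariant s′
    explore-invariant (explore scan) = scan-invariant id scan

    -- The list `ws` shrinks during the scan while new arcs must lie in all of `adj u`, hence the
    -- inclusion as a premise.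
    scan-invariant : ∀ {u ws s s′} → (∀ {w} → w ∈ ws → w ∈ adj u) →
                     Scan adj u ws s s′ → Invariant s → Invariant s′
    scan-invariant ws⊆adj done inv = inv
    scan-invariant ws⊆adj (skip _ scan) inv = scan-invariant (ws⊆adj ∘ there) scan inv
    scan-invariant ws⊆adj (discover w∉s exp scan) inv =
      scan-invariant (ws⊆adj ∘ there) scan
        (explore-invariant exp (invariant-discover (ws⊆adj (here refl)) w∉s inv))

  search-invariant : ∀ {vs s s′} → Search adj vs s s′ → Invariant s → Invariant s′
  search-invariant done inv = inv
  search-invariant (skip _ search) inv = search-invariant search inv
  search-invariant (start _ exp search) inv =
    search-invariant search (explore-invariant exp (invariant-mark inv))

-- Paths in forests with unique parents

module _ {n : ℕ} {r} {R : Rel (Fin n) r} where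

  -- Unique parents determine the last arc of a path, whereas `Star` exposes the first.
  unsnoc : ∀ {x z} → Star R x z → x ≡ z ⊎ ∃ λ y → Star R x y × R y z
  unsnoc ε = inj₁ refl
  unsnoc (e ◅ es) with unsnoc es
  ... | inj₁ refl            = inj₂ (_ , ε , e)
  ... | inj₂ (y , es′ , e′) = inj₂ (y , e ◅ es′ , e′)

module Forest {n : ℕ} {F : List (Fin n × Fin n)} (uniqueParents : UniqueParents F) where

  Below : Rel (Fin n) 0ℓ
  Below = Star (Arc F)

  -- Read backwards from `z`, both paths climb through the same unique parents, so one is a suffix
  -- of the other.
  ancestors-comparable : ∀ {x y z} → Below x z → Below y z → Below x y ⊎ Below y x
  ancestors-comparable ε y⇝z = inj₂ y⇝z
  ancestors-comparable (e ◅ es) y⇝z with ancestors-comparable es y⇝z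
  ... | inj₁ x′⇝y = inj₁ (e ◅ x′⇝y)
  ... | inj₂ y⇝x′ with unsnoc y⇝x′
  ...   | inj₁ refl = inj₁ (e ◅ ε)
  ...   | inj₂ (_ , y⇝u , e′) = inj₂ (subst (Below _) (uniqueParents e′ e) y⇝u)

  module _ {v : Fin n} (root : IsRoot F v) where

    above-root : ∀ {c} → Below c v → c ≡ v
    above-root c⇝v with unsnoc c⇝v
    ... | inj₁ c≡v         = c≡v
    ... | inj₂ (u , _ , e) = contradiction e (root u)

    -- Along an undirected walk from `v` a directed path from `v` is maintained: a forward step
    -- extends it, and a backward step removes its last arc, by uniqueness of parents. The path
    -- cannot be empty then, as the root has no incoming arc.
    component⇒below : ∀ {w} → Component F v w → Below v w
    component⇒below = go ε
      where
      go : ∀ {u w} → Below v u → Component F u w → Below v w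
      go v⇝u ε = v⇝u
      go v⇝u (fwd e ◅ es) = go (v⇝u ◅◅ (e ◅ ε)) es
      go v⇝u (bwd e ◅ es) with unsnoc v⇝u
      ... | inj₁ refl = contradiction e (root _)
      ... | inj₂ (_ , v⇝y , e′) = go (subst (Below v) (uniqueParents e′ e) v⇝y) es

    -- A nonempty path from `a` to `b` would enter `b` through its parent `v`, putting `a` above the
    -- root.
    siblings-incomparable : ∀ {a b} → Arc F v a → Arc F v b → a ≢ b → ¬ Below a b
    siblings-incomparable va vb a≢b a⇝b with unsnoc a⇝b
    ... | inj₁ a≡b = a≢b a≡b
    ... | inj₂ (_ , a⇝u , ub) with uniqueParents ub vb
    ...   | refl with above-root a⇝u
    ...     | refl = root _ va

    subtrees-disjoint : ∀ {a b w} → Arc F v a → Arc F v b → a ≢ b →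
                        Below a w → ¬ Below b w
    subtrees-disjoint va vb a≢b a⇝w b⇝w with ancestors-comparable a⇝w b⇝w
    ... | inj₁ a⇝b = siblings-incomparable va vb a≢b a⇝b
    ... | inj₂ b⇝a = siblings-incomparable vb va (a≢b ∘ sym) b⇝a

below⇒component : ∀ {n} {F : List (Fin n × Fin n)} {v w} →
                  Star (Arc F) v w → Component F v w
below⇒component = Star.map fwd

IsLeaf : ∀ {n} → List (Fin n × Fin n) → Fin n → Set
IsLeaf F p = ∀ w → ¬ Arc F p w

leaf? : ∀ {n} (F : List (Fin n × Fin n)) p → IsLeaf F p ⊎ ∃ (Arc F p)
leaf? F p with any? (λ e → proj₁ e ≟ p) F
... | no  none = inj₁ λ w e → none (lose e refl)
... | yes some with find some
...   | (_ , m) , e , refl = inj₂ (m , e)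

-- Merging

module Merge
  {c ℓ₁ ℓ₂} (O : StrictTotalOrder c ℓ₁ ℓ₂) {n : ℕ}
  (A : Vector (StrictTotalOrder.Carrier O) n) (distinct : Distinct O A)
  {F : List (Fin n × Fin n)}
  (uniqueParents : UniqueParents F)
  (increasing : ∀ {u w} → Arc F u w → StrictTotalOrder._<_ O (A u) (A w))
  -- The arc into `w` exempts roots: `v` itself has two children.
  (uniqueChild : ∀ {u w x y} → Arc F u w → Arc F w x → Arc F w y → x ≡ y)
  {v a b : Fin n} (root : IsRoot F v) (children : HasExactlyTwoChildren F v a b)
  where

  open StrictTotalOrder O using (_<?_; compare; irrefl; isStrictPartialOrder; module Eq)
    renaming (_<_ to _<ᴼ_; trans to <-trans)
  open Forest {F = F} uniqueParents

  _≺_ : Rel (Fin n) ℓ₂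
  x ≺ y = A x <ᴼ A y

  H : Rel (Fin n) ℓ₂
  H = MergedArc O A F v a b

  v→a : Arc F v a
  v→a = Equivalence.from (proj₂ children a) (inj₁ refl)

  v→b : Arc F v b
  v→b = Equivalence.from (proj₂ children b) (inj₂ refl)

  heads-below : ∀ {p q} → MergeState O A F a b (just p) (just q) → Below a p × Below b q
  heads-below initial = ε , ε
  heads-below (advanceP st _ (defined e _)) with heads-below st
  ... | a⇝p , b⇝q = a⇝p ◅◅ (e ◅ ε) , b⇝q
  heads-below (advanceQ st _ (defined e _)) with heads-below st
  ... | a⇝p , b⇝q = a⇝p , b⇝q ◅◅ (e ◅ ε)

  -- The heads stay in disjoint sub-trees. With distinct entries, a failed test `A p < A q`
  -- therefore means `A q < A p`, so added arcs increase strictly.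
  heads-distinct : ∀ {p q} → MergeState O A F a b (just p) (just q) → p ≢ q
  heads-distinct st refl with heads-below st
  ... | a⇝p , b⇝p = subtrees-disjoint root v→a v→b (proj₁ children) a⇝p b⇝p

  H-increasing : ∀ {u w} → H u w → u ≺ w
  H-increasing (inj₁ (_ , _ , e)) = increasing e
  H-increasing (inj₂ (fromP _ p<q)) = p<q
  H-increasing (inj₂ (fromQ {p} {q} st p≮q)) with compare (A p) (A q)
  ... | tri< p<q _ _ = contradiction p<q p≮q
  ... | tri≈ _ p≈q _ = contradiction p≈q (distinct (heads-distinct st))
  ... | tri> _ _ q<p = q<p

  -- The vertices of the tree other than its root. The parent is kept as data because `uniqueChild`
  -- and `treeArc` both consume it.
  Inner : Pred (Fin n) 0ℓ
  Inner w = ∃ λ u → Below v u × Arc F u w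

  inner-child : ∀ {p m} → Inner p → Arc F p m → Inner m
  inner-child (_ , v⇝u , u→p) p→m = _ , v⇝u ◅◅ (u→p ◅ ε) , p→m

  below-inner : ∀ {x w} → Inner x → Below x w → Inner w
  below-inner ix ε        = ix
  below-inner ix (e ◅ es) = below-inner (inner-child ix e) es

  heads-inner : ∀ {p q} → MergeState O A F a b (just p) (just q) → Inner p × Inner q
  heads-inner st with heads-below st
  ... | a⇝p , b⇝q = below-inner (v , ε , v→a) a⇝p , below-inner (v , ε , v→b) b⇝q

  treeArc : ∀ {w} → (iw : Inner w) → H (proj₁ iw) w
  treeArc (_ , v⇝u , e) =
    inj₁ (below⇒component v⇝u , below⇒component (v⇝u ◅◅ (e ◅ ε)) , e)

  onlyChild⇒smallest : ∀ {p m} → Inner p → Arc F p m → SmallestChild O A F p (just m)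
  onlyChild⇒smallest (_ , _ , u→p) p→m = defined p→m λ w p→w w<m →
    irrefl (Eq.reflexive (cong A (uniqueChild u→p p→w p→m))) w<m

  below-leaf : ∀ {p w} → IsLeaf F p → Below p w → p ≡ w
  below-leaf leaf ε       = refl
  below-leaf leaf (e ◅ _) = contradiction e (leaf _)

  below-onlyChild : ∀ {p m w} → Inner p → Arc F p m → Below p w → p ≡ w ⊎ Below m w
  below-onlyChild _ p→m ε = inj₁ refl
  below-onlyChild (_ , _ , u→p) p→m (e ◅ es) =
    inj₂ (subst (λ x → Below x _) (uniqueChild u→p e p→m) es)

  -- Here `r` is the vertex left last and `P` describes the vertices still to be visited, so only
  -- the tail `xs` is matched with `P`.
  PathFrom : ∀ {ℓ} → Fin n → Pred (Fin n) ℓ → Set (ℓ ⊔ ℓ₂)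
  PathFrom r P = ∃ λ xs → Linked H (r ∷ xs) × (∀ {w} → w ∈ xs → P w) × (∀ {w} → P w → w ∈ xs)

  step : ∀ {ℓ ℓ′ r p} {P : Pred (Fin n) ℓ} {Q : Pred (Fin n) ℓ′} → H r p →
         P p → (∀ {w} → Q w → P w) → (∀ {w} → P w → p ≡ w ⊎ Q w) →
         PathFrom p Q → PathFrom r P
  step {p = p} Hrp Pp Q⊆P P⊆ (xs , linked , sound , complete) =
    p ∷ xs , Hrp ∷ linked ,
    (λ { (here refl) → Pp ; (there w∈xs) → Q⊆P (sound w∈xs) }) ,
    (λ Pw → [ (λ { refl → here refl }) , there ∘ complete ]′ (P⊆ Pw))

  -- After one sub-tree is exhausted, the rest of the other is a single path of tree arcs ending in
  -- a leaf.
  descend : ∀ {r p} → Acc (flip _≺_) p → Inner p → H r p → PathFrom r (Below p)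
  descend {p = p} (acc rec) ip Hrp with leaf? F p
  ... | inj₁ leaf =
    step {Q = λ _ → ⊥} Hrp ε (λ ()) (inj₁ ∘ below-leaf leaf) ([] , [-] , (λ ()) , λ ())
  ... | inj₂ (m , p→m) =
    step Hrp ε (p→m ◅_) (below-onlyChild ip p→m)
      (descend (rec (increasing p→m)) im (treeArc im))
    where im = inner-child ip p→m

  -- The invariant is that `r` has arcs to both heads. The smaller head is visited next and inherits
  -- it: a tree arc leads to its child and the added arc to the other head. If it is a leaf, the
  -- added arc alone leads on. Each recursive call raises the value of one head and keeps the other.
  merge : ∀ {r p q} → Acc (flip _≺_) p → Acc (flip _≺_) q →
          MergeState O A F a b (just p) (just q) → H r p → H r q →
          PathFrom r (Below p ∪ Below q)
  merge {p = p} {q} accP@(acc recP) accQ@(acc recQ) st Hrp Hrq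
    with heads-inner st | A p <? A q
  ... | ip , iq | yes p<q with leaf? F p
  ...   | inj₁ leaf =
    step Hrp (inj₁ ε) inj₂ (map₁ (below-leaf leaf))
      (descend accQ iq (inj₂ (fromP st p<q)))
  ...   | inj₂ (m , p→m) =
    step Hrp (inj₁ ε) (map₁ (p→m ◅_)) (assocʳ ∘ map₁ (below-onlyChild ip p→m))
      (merge (recP (increasing p→m)) accQ
        (advanceP st p<q (onlyChild⇒smallest ip p→m))
        (treeArc (inner-child ip p→m)) (inj₂ (fromP st p<q)))
  merge {p = p} {q} accP@(acc recP) accQ@(acc recQ) st Hrp Hrq
      | ip , iq | no p≮q with leaf? F q
  ...   | inj₁ leaf =
    step Hrq (inj₂ ε) inj₁ (swap ∘ map₂ (below-leaf leaf))
      (descend accP ip (inj₂ (fromQ st p≮q)))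
  ...   | inj₂ (m , q→m) =
    step Hrq (inj₂ ε) (map₂ (q→m ◅_))
      [ inj₂ ∘ inj₁ , map₂ inj₂ ∘ below-onlyChild iq q→m ]′
      (merge accP (recQ (increasing q→m))
        (advanceQ st p≮q (onlyChild⇒smallest iq q→m))
        (inj₂ (fromQ st p≮q)) (treeArc (inner-child iq q→m)))

  -- Among finitely many indices no chain of values increases forever.
  ≺-acc : ∀ x → Acc (flip _≺_) x
  ≺-acc = spo-noetherian (On.isStrictPartialOrder A isStrictPartialOrder)

  increasing⇒unique : ∀ {xs} → Linked _≺_ xs → Unique xs
  increasing⇒unique =
    AllPairs.map (λ { x≺y refl → irrefl Eq.refl x≺y }) ∘ Linked⇒AllPairs <-trans

  hamiltonianPath : ∃ (IsHamiltonianPath (Component F v) H)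
  hamiltonianPath
    with merge (≺-acc a) (≺-acc b) initial (treeArc (v , ε , v→a)) (treeArc (v , ε , v→b))
  ... | xs , linked , sound , complete = v ∷ xs , record
    { followsArcs = linked
    ; noRepeats   = increasing⇒unique (Linked.map H-increasing linked)
    ; visits      = λ w → mk⇔ to (from ∘ component⇒below root) }
    where
    to : ∀ {w} → w ∈ v ∷ xs → Component F v w
    to (here refl)  = ε
    to (there w∈xs) =
      below⇒component ([ v→a ◅_ , v→b ◅_ ]′ (sound w∈xs))

    from : ∀ {w} → Below v w → w ∈ v ∷ xs
    from ε = here refl
    from (e ◅ es) with Equivalence.to (proj₂ children _) e
    ... | inj₁ refl = there (complete (inj₁ es))
    ... | inj₂ refl = there (complete (inj₂ es))

-- DFS forests of arrays with reach one

theorem9 : ∀ {c ℓ₁ ℓ₂} (O : StrictTotalOrder c ℓ₁ ℓ₂) (n : ℕ)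
    (A : Vector (StrictTotalOrder.Carrier O) n) → Distinct O A →
    (F : List (Fin n × Fin n)) → IsDFSForest O A F →
    (v a₁ b₁ : Fin n) → IsRoot F v → HasExactlyTwoChildren F v a₁ b₁ →
    ∃ (IsHamiltonianPath (Component F v) (MergedArc O A F v a₁ b₁))
theorem9 O n A distinct F dfs v a₁ b₁ root children =
  Merge.hamiltonianPath O A distinct uniqueParents increasing uniqueChild root children
  where
  open StrictTotalOrder O using (irrefl; module Eq) renaming (_<_ to _<ᴼ_; trans to <-trans)
  open IsDFSForest dfs using (adj; adjacency; run)
  open Invariant (search-invariant adj run (invariant-initial adj))
    using (arcsFollowAdj; uniqueParents)

  reachOne : ∀ {u w} → Arc F u w → ReachOne O A u w
  reachOne e = Equivalence.to (IsSortedAdjacency.lists adjacency _ _) (arcsFollowAdj e)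

  increasing : ∀ {u w} → Arc F u w → A u <ᴼ A w
  increasing = proj₂ ∘ proj₂ ∘ reachOne

  -- Values rise strictly along arcs, so a child of `w` never coincides with its parent and must be
  -- the other neighbour on the cycle.
  grandparent≢ : ∀ {u w x} → Arc F u w → Arc F w x → u ≢ x
  grandparent≢ u→w w→x refl = irrefl Eq.refl (<-trans (increasing u→w) (increasing w→x))

  uniqueChild : ∀ {u w x y} → Arc F u w → Arc F w x → Arc F w y → x ≡ y
  uniqueChild {u} {w} {x} {y} u→w w→x w→y =
    other-neighbour-unique {w = w} {u} {x} {y}
      (adjacent-sym {i = u} {w} (proj₁ (reachOne u→w)))
      (proj₁ (reachOne w→x)) (proj₁ (reachOne w→y))
      (grandparent≢ u→w w→x) (grandparent≢ u→w w→y)
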